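{- Let $n$ be a positive integer. If $n$ is odd, then $$\left\lfloor \left(\sum_{k=n}^{\infty} \frac{1}{J_{k}^{2}}\right)^{ -1}\right\rfloor \geq J_{n-1}J_{n}.$$
   Context: The Jacobsthal numbers $(J_n)_{n\ge 0}$ are defined by $J_0=0$, $J_1=1$ and $J_{n+2}=J_{n+1}+2J_n$ for $n\ge 0$; the first terms are $0,1,1,3,5,11,21,43,85,\dots$. Here $\lfloor x\rfloor$ denotes the greatest integer not exceeding the real number $x$. -}

module Defs where

open import Data.Nat.Base as ℕ using (ℕ; zero; suc; s≤s; z≤n)
import Data.Nat.Properties as ℕ
import Data.Nat.Solver as ℕSolver
open import Data.Integer.Base as ℤ using (ℤ; +_; -[1+_])
import Data.Integer.Properties as ℤ
open import Data.Rational.Base as ℚ using (ℚ; mkℚ; 0ℚ; 1ℚ; ½; _/_; 1/_; ∣_∣; toℚᵘ; *≤*; *<*)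
import Data.Rational.Properties as ℚ
import Data.Rational.Solver as ℚSolver
open import Data.Rational.Unnormalised.Base as ℚᵘ using (mkℚᵘ; *≡*)
import Data.Rational.Unnormalised.Properties as ℚᵘ
open import Data.Product.Base using (∃; ∃-syntax; _×_; _,_; proj₁; proj₂)
open import Data.Sum.Base using (inj₁; inj₂)
open import Relation.Nullary using (¬_; yes; no; contradiction)
open import Relation.Binary.PropositionalEquality
  using (_≡_; refl; sym; trans; cong; cong₂; subst; subst₂; module ≡-Reasoning)

J : ℕ → ℕ
J 0             = 0
J 1             = 1
J (suc (suc n)) = J (suc n) ℕ.+ 2 ℕ.* J n

J-nonZero : ∀ k .{{_ : ℕ.NonZero k}} → ℕ.NonZero (J k)
J-nonZero 1             = _
J-nonZero (suc (suc k)) = ℕ.>-nonZero (ℕ.<-≤-trans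
  (ℕ.>-nonZero⁻¹ (J (suc k)) {{J-nonZero (suc k)}}) (ℕ.m≤m+n (J (suc k)) _))

1/J² : ∀ k .{{_ : ℕ.NonZero k}} → ℚ
1/J² k = (+ 1 / J k ℕ.^ 2) {{ℕ.m^n≢0 (J k) 2 {{J-nonZero k}}}}

IsCauchy : (ℕ → ℚ) → Set
IsCauchy x = ∀ ε → 0ℚ ℚ.< ε →
  ∃[ N ] ∀ m n → N ℕ.≤ m → N ℕ.≤ n → ∣ x m ℚ.- x n ∣ ℚ.< ε

record ℝ : Set where
  constructor mkℝ
  field
    seq      : ℕ → ℚ
    isCauchy : IsCauchy seq

open ℝ public

infix 4 _≤ʳ_ _<ʳ_

_≤ʳ_ : ℝ → ℝ → Set
x ≤ʳ y = ∀ ε → 0ℚ ℚ.< ε → ∃[ N ] ∀ n → N ℕ.≤ n → seq x n ℚ.≤ seq y n ℚ.+ ε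

-- Cauchy sequences eventually separated by a fixed gap; a pointwise strict
-- inequality would not exclude equal limits.
_<ʳ_ : ℝ → ℝ → Set
x <ʳ y = ∃[ ε ] 0ℚ ℚ.< ε × ∃[ N ] ∀ n → N ℕ.≤ n → seq x n ℚ.+ ε ℚ.≤ seq y n

fromℚ : ℚ → ℝ
fromℚ q = mkℝ (λ _ → q) λ ε 0<ε → 0 , λ _ _ _ _ →
  subst (λ r → ∣ r ∣ ℚ.< ε) (sym (ℚ.+-inverseʳ q)) 0<ε

fromℤ : ℤ → ℝ
fromℤ m = fromℚ (m / 1)

0ʳ : ℝ
0ʳ = fromℚ 0ℚ

-- ⌊ x ⌋ is a relation because the floor of a Cauchy real is not computable.
-- It is single-valued (⌊⌋-unique) and, classically, total (⌊⌋-exists).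
infix 4 ⌊_⌋≡_

⌊_⌋≡_ : ℝ → ℤ → Set
⌊ x ⌋≡ m = fromℤ m ≤ʳ x × (∀ k → fromℤ k ≤ʳ x → k ℤ.≤ m)

⌊⌋-unique : ∀ {x m n} → ⌊ x ⌋≡ m → ⌊ x ⌋≡ n → m ≡ n
⌊⌋-unique (m≤x , m-max) (n≤x , n-max) = ℤ.≤-antisym (n-max _ m≤x) (m-max _ n≤x)

private
  fromℤ-mono : ∀ {k m} → k ℤ.≤ m → (k / 1) ℚ.≤ (m / 1)
  fromℤ-mono {k} {m} k≤m = ℚ.toℚᵘ-cancel-≤ (begin
    toℚᵘ (k / 1)  ≃⟨ ℚ.toℚᵘ-fromℚᵘ (mkℚᵘ k 0) ⟩
    mkℚᵘ k 0      ≤⟨ ℚᵘ.*≤* (ℤ.*-monoʳ-≤-nonNeg (+ 1) k≤m) ⟩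
    mkℚᵘ m 0      ≃⟨ ℚᵘ.≃-sym (ℚ.toℚᵘ-fromℚᵘ (mkℚᵘ m 0)) ⟩
    toℚᵘ (m / 1)  ∎)
    where open ℚᵘ.≤-Reasoning

  fromℤ-≤ʳ : ∀ {k m} x → k ℤ.≤ m → fromℤ m ≤ʳ x → fromℤ k ≤ʳ x
  fromℤ-≤ʳ x k≤m m≤x ε 0<ε with m≤x ε 0<ε
  ... | N , h = N , λ n N≤n → ℚ.≤-trans (fromℤ-mono k≤m) (h n N≤n)

  search : ∀ x d a → fromℤ a ≤ʳ x → ¬ (fromℤ (+ d ℤ.+ a) ≤ʳ x) → ¬ ¬ (∃[ m ] ⌊ x ⌋≡ m)
  search x zero a a≤x a≰x _ =
    a≰x (subst (λ b → fromℤ b ≤ʳ x) (sym (ℤ.+-identityˡ a)) a≤x)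
  search x (suc d) a a≤x b≰x ¬floor = ¬floor (a , a≤x , λ k k≤x → ℤ.≮⇒≥ λ a<k →
    search x d (ℤ.suc a) (fromℤ-≤ʳ x (ℤ.i<j⇒suc[i]≤j a<k) k≤x)
      (λ h → b≰x (subst (λ b → fromℤ b ≤ʳ x) shift h)) ¬floor)
    where
    shift : + d ℤ.+ ℤ.suc a ≡ + suc d ℤ.+ a
    shift = trans (sym (ℤ.+-assoc (+ d) (+ 1) a))
                  (cong (ℤ._+ a) (ℤ.+-comm (+ d) (+ 1)))

  frac≤ : ∀ a b c d .{{_ : ℕ.NonZero b}} .{{_ : ℕ.NonZero d}} →
          a ℕ.* d ℕ.≤ c ℕ.* b → (+ a / b) ℚ.≤ (+ c / d)
  frac≤ a b@(suc b′) c d@(suc d′) ad≤cb = ℚ.toℚᵘ-cancel-≤ (begin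
    toℚᵘ (+ a / b)   ≃⟨ ℚ.toℚᵘ-fromℚᵘ (mkℚᵘ (+ a) b′) ⟩
    mkℚᵘ (+ a) b′    ≤⟨ ℚᵘ.*≤* (subst₂ ℤ._≤_ (ℤ.pos-* a d) (ℤ.pos-* c b) (ℤ.+≤+ ad≤cb)) ⟩
    mkℚᵘ (+ c) d′    ≃⟨ ℚᵘ.≃-sym (ℚ.toℚᵘ-fromℚᵘ (mkℚᵘ (+ c) d′)) ⟩
    toℚᵘ (+ c / d)   ∎)
    where open ℚᵘ.≤-Reasoning

  frac+ : ∀ a b c d .{{_ : ℕ.NonZero b}} .{{_ : ℕ.NonZero d}} .{{_ : ℕ.NonZero (b ℕ.* d)}} →
          (+ a / b) ℚ.+ (+ c / d) ≡ (+ (a ℕ.* d ℕ.+ c ℕ.* b) / (b ℕ.* d))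
  frac+ a b@(suc b′) c d@(suc d′) = ℚ.toℚᵘ-injective (begin
    toℚᵘ ((+ a / b) ℚ.+ (+ c / d))           ≈⟨ ℚ.toℚᵘ-homo-+ (+ a / b) (+ c / d) ⟩
    toℚᵘ (+ a / b) ℚᵘ.+ toℚᵘ (+ c / d)       ≈⟨ ℚᵘ.+-cong (ℚ.toℚᵘ-fromℚᵘ (mkℚᵘ (+ a) b′))
                                                          (ℚ.toℚᵘ-fromℚᵘ (mkℚᵘ (+ c) d′)) ⟩
    mkℚᵘ (+ a) b′ ℚᵘ.+ mkℚᵘ (+ c) d′         ≈⟨ *≡* (cong (ℤ._* + (b ℕ.* d))
                                                  (cong₂ ℤ._+_ (sym (ℤ.pos-* a d)) (sym (ℤ.pos-* c b)))) ⟩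
    mkℚᵘ (+ (a ℕ.* d ℕ.+ c ℕ.* b)) (d′ ℕ.+ b′ ℕ.* d)
      ≈⟨ ℚᵘ.≃-sym (ℚ.toℚᵘ-fromℚᵘ (mkℚᵘ (+ (a ℕ.* d ℕ.+ c ℕ.* b)) (d′ ℕ.+ b′ ℕ.* d))) ⟩
    toℚᵘ (+ (a ℕ.* d ℕ.+ c ℕ.* b) / (b ℕ.* d)) ∎)
    where open ℚᵘ.≃-Reasoning

  p≤∣p∣ : ∀ p → p ℚ.≤ ∣ p ∣
  p≤∣p∣ p with ℚ.≤-total 0ℚ p
  ... | inj₁ 0≤p = ℚ.≤-reflexive (sym (ℚ.0≤p⇒∣p∣≡p 0≤p))
  ... | inj₂ p≤0 = ℚ.≤-trans p≤0 (ℚ.0≤∣p∣ p)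

  ∣p∣≤↥p : ∀ p → ∣ p ∣ ℚ.≤ (+ ℤ.∣ ℚ.↥ p ∣ / 1)
  ∣p∣≤↥p p@(mkℚ n d _) = subst (ℚ._≤ (+ ℤ.∣ n ∣ / 1)) (ℚ.↥p/↧p≡p ∣ p ∣)
    (frac≤ ℤ.∣ n ∣ (suc d) ℤ.∣ n ∣ 1 (ℕ.*-monoʳ-≤ ℤ.∣ n ∣ (s≤s z≤n)))

  negneg : ∀ p → ℚ.- (ℚ.- p) ≡ p
  negneg = solve 1 (λ p → :- (:- p) := p) refl
    where open ℚSolver.+-*-Solver

  split : ∀ p q → p ≡ (p ℚ.- q) ℚ.+ q
  split = solve 2 (λ p q → p := (p :- q) :+ q) refl
    where open ℚSolver.+-*-Solver

  eventually-bounded : ∀ x → ∃[ B ] ∃[ N ] ∀ n → N ℕ.≤ n → ∣ seq x n ∣ ℚ.≤ (+ B / 1)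
  eventually-bounded x with isCauchy x 1ℚ (*<* (ℤ.+<+ (s≤s z≤n)))
  ... | N , h = suc b , N , λ n N≤n → begin
    ∣ s n ∣                        ≡⟨ cong ∣_∣ (split (s n) (s N)) ⟩
    ∣ (s n ℚ.- s N) ℚ.+ s N ∣      ≤⟨ ℚ.∣p+q∣≤∣p∣+∣q∣ (s n ℚ.- s N) (s N) ⟩
    ∣ s n ℚ.- s N ∣ ℚ.+ ∣ s N ∣    ≤⟨ ℚ.+-mono-≤ (ℚ.<⇒≤ (h n N N≤n ℕ.≤-refl)) (∣p∣≤↥p (s N)) ⟩
    1ℚ ℚ.+ (+ b / 1)               ≡⟨ trans (frac+ 1 1 b 1) (cong (λ k → + suc k / 1) (ℕ.*-identityʳ b)) ⟩
    + suc b / 1                    ∎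
    where
    open ℚ.≤-Reasoning
    s = seq x
    b = ℤ.∣ ℚ.↥ s N ∣

  neg-/1 : ∀ m → (ℤ.- m) / 1 ≡ ℚ.- (m / 1)
  neg-/1 (+ zero)   = refl
  neg-/1 (+ suc m)  = refl
  neg-/1 (-[1+ m ]) = sym (negneg _)

  lower-bound : ∀ {b x N} → (∀ n → N ℕ.≤ n → ∣ seq x n ∣ ℚ.≤ b) → fromℚ (ℚ.- b) ≤ʳ x
  lower-bound {b} {x} {N} h ε 0<ε = N , λ n N≤n → begin
    ℚ.- b                 ≤⟨ ℚ.neg-antimono-≤ (ℚ.≤-trans (p≤∣p∣ (ℚ.- seq x n))
                               (subst (ℚ._≤ b) (sym (ℚ.∣-p∣≡∣p∣ (seq x n))) (h n N≤n))) ⟩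
    ℚ.- (ℚ.- seq x n)     ≡⟨ negneg (seq x n) ⟩
    seq x n               ≡⟨ sym (ℚ.+-identityʳ (seq x n)) ⟩
    seq x n ℚ.+ 0ℚ        ≤⟨ ℚ.+-monoʳ-≤ (seq x n) (ℚ.<⇒≤ 0<ε) ⟩
    seq x n ℚ.+ ε         ∎
    where open ℚ.≤-Reasoning

  upper-bound : ∀ {b x N} → (∀ n → N ℕ.≤ n → ∣ seq x n ∣ ℚ.≤ b) → ¬ (fromℚ (1ℚ ℚ.+ b) ≤ʳ x)
  upper-bound {b} {x} {N} h le = ℚ.<-irrefl refl (begin-strict
    ½ ℚ.+ b            <⟨ ℚ.+-monoˡ-< b ½<1 ⟩
    1ℚ ℚ.+ b           ≤⟨ proj₂ (le ½ 0<½) n (ℕ.m≤n⊔m N (proj₁ (le ½ 0<½))) ⟩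
    seq x n ℚ.+ ½      ≤⟨ ℚ.+-monoˡ-≤ ½ (ℚ.≤-trans (p≤∣p∣ (seq x n)) (h n (ℕ.m≤m⊔n N _))) ⟩
    b ℚ.+ ½            ≡⟨ ℚ.+-comm b ½ ⟩
    ½ ℚ.+ b            ∎)
    where
    open ℚ.≤-Reasoning
    0<½ : 0ℚ ℚ.< ½
    0<½ = *<* (ℤ.+<+ (s≤s z≤n))
    ½<1 : ½ ℚ.< 1ℚ
    ½<1 = *<* (ℤ.+<+ (s≤s (s≤s z≤n)))
    n = N ℕ.⊔ proj₁ (le ½ 0<½)

  suc-/1 : ∀ b → 1ℚ ℚ.+ (+ b / 1) ≡ (+ suc b / 1)
  suc-/1 b = trans (frac+ 1 1 b 1) (cong (λ k → + suc k / 1) (ℕ.*-identityʳ b))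

⌊⌋-exists : ∀ x → ¬ ¬ (∃[ m ] ⌊ x ⌋≡ m)
⌊⌋-exists x =
  let B , N , h = eventually-bounded x
      top : + (suc B ℕ.+ B) ℤ.+ (ℤ.- + B) ≡ + suc B
      top = trans (ℤ.+-assoc (+ suc B) (+ B) (ℤ.- + B))
            (trans (cong (ℤ._+_ (+ suc B)) (ℤ.+-inverseʳ (+ B))) (ℤ.+-identityʳ _))
  in search x (suc B ℕ.+ B) (ℤ.- + B)
       (subst (λ b → fromℚ b ≤ʳ x) (sym (neg-/1 (+ B))) (lower-bound {x = x} h))
       (λ le → upper-bound {x = x} h (subst (λ b → fromℚ b ≤ʳ x)
         (trans (cong (_/ 1) top) (sym (suc-/1 B))) le))

-- The value at 0 is irrelevant below: a Cauchy sequence representing a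
-- positive real is eventually bounded away from 0.
recip : ℚ → ℚ
recip p with p ℚ.≟ 0ℚ
... | yes _  = 0ℚ
... | no p≢0 = (1/ p) {{ℚ.≢-nonZero p≢0}}

private
  recip-inverse : ∀ {p} → 0ℚ ℚ.< p → p ℚ.* recip p ≡ 1ℚ
  recip-inverse {p} 0<p with p ℚ.≟ 0ℚ
  ... | yes p≡0 = contradiction (sym p≡0) (ℚ.<⇒≢ 0<p)
  ... | no p≢0  = ℚ.*-inverseʳ p {{ℚ.≢-nonZero p≢0}}

  recip-pos : ∀ {p} → 0ℚ ℚ.< p → ℚ.Positive (recip p)
  recip-pos {p} 0<p with p ℚ.≟ 0ℚ
  ... | yes p≡0 = contradiction (sym p≡0) (ℚ.<⇒≢ 0<p)
  ... | no p≢0  = ℚ.1/pos⇒pos p {{ℚ.positive 0<p}}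

  nonNeg : ∀ p → ℚ.Positive p → ℚ.NonNegative p
  nonNeg p pos = ℚ.pos⇒nonNeg p {{pos}}

  recip-antimono : ∀ {δ p} → 0ℚ ℚ.< δ → δ ℚ.≤ p → recip p ℚ.≤ recip δ
  recip-antimono {δ} {p} 0<δ δ≤p = begin
    recip p                        ≡⟨ sym (ℚ.*-identityˡ _) ⟩
    1ℚ ℚ.* recip p                 ≡⟨ cong (ℚ._* recip p) (sym (recip-inverse 0<δ)) ⟩
    (δ ℚ.* recip δ) ℚ.* recip p    ≤⟨ ℚ.*-monoʳ-≤-nonNeg (recip p) {{nonNeg (recip p) (recip-pos 0<p)}}
                                      (ℚ.*-monoʳ-≤-nonNeg (recip δ) {{nonNeg (recip δ) (recip-pos 0<δ)}} δ≤p) ⟩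
    (p ℚ.* recip δ) ℚ.* recip p    ≡⟨ swap p (recip δ) (recip p) ⟩
    (p ℚ.* recip p) ℚ.* recip δ    ≡⟨ cong (ℚ._* recip δ) (recip-inverse 0<p) ⟩
    1ℚ ℚ.* recip δ                 ≡⟨ ℚ.*-identityˡ _ ⟩
    recip δ                        ∎
    where
    open ℚ.≤-Reasoning
    0<p = ℚ.<-≤-trans 0<δ δ≤p
    swap : ∀ a b c → (a ℚ.* b) ℚ.* c ≡ (a ℚ.* c) ℚ.* b
    swap = solve 3 (λ a b c → (a :* b) :* c := (a :* c) :* b) refl
      where open ℚSolver.+-*-Solver

  recip-diff : ∀ {p q} → 0ℚ ℚ.< p → 0ℚ ℚ.< q →
               recip p ℚ.- recip q ≡ (q ℚ.- p) ℚ.* (recip p ℚ.* recip q)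
  recip-diff {p} {q} 0<p 0<q = begin
    a ℚ.- b                                   ≡⟨ cong₂ ℚ._-_ (sym (ℚ.*-identityˡ a)) (sym (ℚ.*-identityˡ b)) ⟩
    1ℚ ℚ.* a ℚ.- 1ℚ ℚ.* b                     ≡⟨ cong₂ (λ u v → u ℚ.* a ℚ.- v ℚ.* b)
                                                   (sym (recip-inverse 0<q)) (sym (recip-inverse 0<p)) ⟩
    (q ℚ.* b) ℚ.* a ℚ.- (p ℚ.* a) ℚ.* b       ≡⟨ collect p q a b ⟩
    (q ℚ.- p) ℚ.* (a ℚ.* b)                   ∎
    where
    open ≡-Reasoning
    a = recip p
    b = recip q
    collect : ∀ p q a b → (q ℚ.* b) ℚ.* a ℚ.- (p ℚ.* a) ℚ.* b ≡ (q ℚ.- p) ℚ.* (a ℚ.* b)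
    collect = solve 4 (λ p q a b →
      (q :* b) :* a :- (p :* a) :* b := (q :- p) :* (a :* b)) refl
      where open ℚSolver.+-*-Solver

  recip-close : ∀ {δ ε p q} → 0ℚ ℚ.< δ → δ ℚ.≤ p → δ ℚ.≤ q →
                ∣ q ℚ.- p ∣ ℚ.< ε ℚ.* (δ ℚ.* δ) → ∣ recip p ℚ.- recip q ∣ ℚ.< ε
  recip-close {δ} {ε} {p} {q} 0<δ δ≤p δ≤q close = begin-strict
    ∣ recip p ℚ.- recip q ∣                            ≡⟨ cong ∣_∣ (recip-diff 0<p 0<q) ⟩
    ∣ (q ℚ.- p) ℚ.* (recip p ℚ.* recip q) ∣            ≡⟨ ℚ.∣p*q∣≡∣p∣*∣q∣ (q ℚ.- p) _ ⟩
    ∣ q ℚ.- p ∣ ℚ.* ∣ recip p ℚ.* recip q ∣            ≡⟨ cong (∣ q ℚ.- p ∣ ℚ.*_)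
      (ℚ.0≤p⇒∣p∣≡p (ℚ.nonNegative⁻¹ _ {{nonNeg (recip p ℚ.* recip q) (ℚ.pos*pos⇒pos (recip p) {{posp}} (recip q) {{posq}})}})) ⟩
    ∣ q ℚ.- p ∣ ℚ.* (recip p ℚ.* recip q)              ≤⟨ ℚ.*-monoˡ-≤-nonNeg ∣ q ℚ.- p ∣ {{ℚ.∣-∣-nonNeg (q ℚ.- p)}} r≤ ⟩
    ∣ q ℚ.- p ∣ ℚ.* (recip δ ℚ.* recip δ)              <⟨ ℚ.*-monoˡ-<-pos (recip δ ℚ.* recip δ)
                                                           {{ℚ.pos*pos⇒pos (recip δ) {{posδ}} (recip δ) {{posδ}}}} close ⟩
    (ε ℚ.* (δ ℚ.* δ)) ℚ.* (recip δ ℚ.* recip δ)        ≡⟨ regroup ε δ (recip δ) ⟩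
    ε ℚ.* ((δ ℚ.* recip δ) ℚ.* (δ ℚ.* recip δ))        ≡⟨ cong (λ u → ε ℚ.* (u ℚ.* u)) (recip-inverse 0<δ) ⟩
    ε ℚ.* 1ℚ                                           ≡⟨ ℚ.*-identityʳ ε ⟩
    ε                                                  ∎
    where
    open ℚ.≤-Reasoning
    0<p = ℚ.<-≤-trans 0<δ δ≤p
    0<q = ℚ.<-≤-trans 0<δ δ≤q
    posp = recip-pos 0<p
    posq = recip-pos 0<q
    posδ = recip-pos 0<δ
    r≤ : recip p ℚ.* recip q ℚ.≤ recip δ ℚ.* recip δ
    r≤ = ℚ.≤-trans (ℚ.*-monoʳ-≤-nonNeg (recip q) {{nonNeg (recip q) posq}} (recip-antimono 0<δ δ≤p))
                   (ℚ.*-monoˡ-≤-nonNeg (recip δ) {{nonNeg (recip δ) posδ}} (recip-antimono 0<δ δ≤q))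
    regroup : ∀ e d r → (e ℚ.* (d ℚ.* d)) ℚ.* (r ℚ.* r) ≡ e ℚ.* ((d ℚ.* r) ℚ.* (d ℚ.* r))
    regroup = solve 3 (λ e d r → (e :* (d :* d)) :* (r :* r) := e :* ((d :* r) :* (d :* r))) refl
      where open ℚSolver.+-*-Solver

  recip-cauchy : ∀ x → 0ʳ <ʳ x → IsCauchy (λ n → recip (seq x n))
  recip-cauchy x (δ , 0<δ , N , h) ε 0<ε
    with isCauchy x (ε ℚ.* (δ ℚ.* δ)) (ℚ.positive⁻¹ _ {{ℚ.pos*pos⇒pos ε {{ℚ.positive 0<ε}} (δ ℚ.* δ)
           {{ℚ.pos*pos⇒pos δ {{ℚ.positive 0<δ}} δ {{ℚ.positive 0<δ}}}}}})
  ... | M , g = N ℕ.⊔ M , λ m n le le′ → recip-close 0<δ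
      (bound m (ℕ.m⊔n≤o⇒m≤o N M le)) (bound n (ℕ.m⊔n≤o⇒m≤o N M le′))
      (g n m (ℕ.m⊔n≤o⇒n≤o N M le′) (ℕ.m⊔n≤o⇒n≤o N M le))
    where
    bound : ∀ n → N ℕ.≤ n → δ ℚ.≤ seq x n
    bound n N≤n = subst (ℚ._≤ seq x n) (ℚ.+-identityˡ δ) (h n N≤n)

inverse : (x : ℝ) → 0ʳ <ʳ x → ℝ
inverse x 0<x = mkℝ (λ n → recip (seq x n)) (recip-cauchy x 0<x)

inverse-correct : ∀ x (0<x : 0ʳ <ʳ x) →
  ∃[ N ] ∀ n → N ℕ.≤ n → seq x n ℚ.* seq (inverse x 0<x) n ≡ 1ℚ
inverse-correct x (δ , 0<δ , N , h) = N , λ n N≤n →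
  recip-inverse (ℚ.<-≤-trans 0<δ (subst (ℚ._≤ seq x n) (ℚ.+-identityˡ δ) (h n N≤n)))

partialSum : (ℕ → ℚ) → ℕ → ℚ
partialSum a zero    = 0ℚ
partialSum a (suc m) = partialSum a m ℚ.+ a m

Summable : (ℕ → ℚ) → Set
Summable a = IsCauchy (partialSum a)

-- The real represented by a Cauchy sequence of rationals is its limit.
∑∞ : (a : ℕ → ℚ) → Summable a → ℝ
∑∞ a summable = mkℝ (partialSum a) summable

+-nonZero : ∀ n i .{{_ : ℕ.NonZero n}} → ℕ.NonZero (n ℕ.+ i)
+-nonZero (suc _) _ = _

-- The terms 1/J_k² for k ≥ n, reindexed by i = k − n.
tailTerm : (n : ℕ) .{{_ : ℕ.NonZero n}} → ℕ → ℚ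
tailTerm n i = 1/J² (n ℕ.+ i) {{+-nonZero n i}}

private
  0≤frac : ∀ a b .{{_ : ℕ.NonZero b}} → 0ℚ ℚ.≤ (+ a / b)
  0≤frac a b = frac≤ 0 1 a b z≤n

  k≤2J : ∀ k → k ℕ.≤ 2 ℕ.* J k
  k≤2J 0 = z≤n
  k≤2J 1 = s≤s z≤n
  k≤2J 2 = s≤s (s≤s z≤n)
  k≤2J (suc (suc k@(suc _))) = begin
    suc (suc k)                                ≡⟨ ℕ.+-comm 1 (suc k) ⟩
    suc k ℕ.+ 1                                ≤⟨ ℕ.+-mono-≤ (k≤2J (suc k)) one ⟩
    2 ℕ.* J (suc k) ℕ.+ 2 ℕ.* (2 ℕ.* J k)      ≡⟨ sym (ℕ.*-distribˡ-+ 2 (J (suc k)) (2 ℕ.* J k)) ⟩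
    2 ℕ.* J (suc (suc k))                      ∎
    where
    open ℕ.≤-Reasoning
    one : 1 ℕ.≤ 2 ℕ.* (2 ℕ.* J k)
    one = ℕ.≤-trans (ℕ.>-nonZero⁻¹ (J k) {{J-nonZero k}}) (ℕ.≤-trans (ℕ.m≤m+n (J k) _) (ℕ.m≤m+n (2 ℕ.* J k) _))

  majorant : ℕ → ℚ
  majorant i = + 8 / suc i

  telescoping-bound : ∀ j i .{{_ : ℕ.NonZero (j ℕ.^ 2)}} → suc i ℕ.≤ 2 ℕ.* j →
    (+ 1 / j ℕ.^ 2) ℚ.+ majorant (suc i) ℚ.≤ majorant i
  telescoping-bound j i i<2j = subst (ℚ._≤ majorant i) (sym (frac+ 1 (j ℕ.^ 2) 8 (suc (suc i)) {{nz}} {{_}} {{nz′}}))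
    (frac≤ (1 ℕ.* suc (suc i) ℕ.+ 8 ℕ.* j ℕ.^ 2) (j ℕ.^ 2 ℕ.* suc (suc i)) 8 (suc i) {{nz′}} (begin
      (1 ℕ.* suc (suc i) ℕ.+ 8 ℕ.* j ℕ.^ 2) ℕ.* suc i                  ≡⟨ expand i (j ℕ.^ 2) ⟩
      suc (suc i) ℕ.* suc i ℕ.+ 8 ℕ.* j ℕ.^ 2 ℕ.* suc i                ≤⟨ ℕ.+-monoˡ-≤ _ key ⟩
      8 ℕ.* j ℕ.^ 2 ℕ.+ 8 ℕ.* j ℕ.^ 2 ℕ.* suc i                        ≡⟨ collect i (j ℕ.^ 2) ⟩
      8 ℕ.* (j ℕ.^ 2 ℕ.* suc (suc i))                                  ∎))
    where
    open ℕ.≤-Reasoning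
    open ℕSolver.+-*-Solver
    instance
      nz : ℕ.NonZero (j ℕ.^ 2)
      nz = ℕ.m^n≢0 j 2 {{ℕ.≢-nonZero λ { refl → ℕ.<⇒≱ (s≤s z≤n) i<2j }}}
      nz′ : ℕ.NonZero (j ℕ.^ 2 ℕ.* suc (suc i))
      nz′ = ℕ.m*n≢0 (j ℕ.^ 2) (suc (suc i))
    expand : ∀ i s → (1 ℕ.* suc (suc i) ℕ.+ 8 ℕ.* s) ℕ.* suc i ≡ suc (suc i) ℕ.* suc i ℕ.+ 8 ℕ.* s ℕ.* suc i
    expand = solve 2 (λ i s → (con 1 :* (con 2 :+ i) :+ con 8 :* s) :* (con 1 :+ i)
                           := (con 2 :+ i) :* (con 1 :+ i) :+ con 8 :* s :* (con 1 :+ i)) refl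
    collect : ∀ i s → 8 ℕ.* s ℕ.+ 8 ℕ.* s ℕ.* suc i ≡ 8 ℕ.* (s ℕ.* suc (suc i))
    collect = solve 2 (λ i s → con 8 :* s :+ con 8 :* s :* (con 1 :+ i)
                            := con 8 :* (s :* (con 2 :+ i))) refl
    square : ∀ j → (2 ℕ.* (2 ℕ.* j)) ℕ.* (2 ℕ.* j) ≡ 8 ℕ.* j ℕ.^ 2
    square = solve 1 (λ j → (con 2 :* (con 2 :* j)) :* (con 2 :* j) := con 8 :* j :^ 2) refl
    double : suc (suc i) ℕ.≤ 2 ℕ.* suc i
    double = s≤s (ℕ.≤-trans (s≤s (ℕ.m≤m+n i _)) (ℕ.m≤n+m (suc (i ℕ.+ 0)) i))
    key : suc (suc i) ℕ.* suc i ℕ.≤ 8 ℕ.* j ℕ.^ 2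
    key = ℕ.≤-trans (ℕ.*-mono-≤ (ℕ.≤-trans double (ℕ.*-monoʳ-≤ 2 i<2j)) i<2j) (ℕ.≤-reflexive (square j))

  tailTerm-bound : ∀ n .{{_ : ℕ.NonZero n}} i →
    tailTerm n i ℚ.+ majorant (suc i) ℚ.≤ majorant i
  tailTerm-bound n@(suc n′) i = telescoping-bound (J (n ℕ.+ i)) i {{ℕ.m^n≢0 (J (n ℕ.+ i)) 2 {{J-nonZero (n ℕ.+ i)}}}}
    (ℕ.≤-trans (s≤s (ℕ.m≤n+m i n′)) (k≤2J (n ℕ.+ i)))

  0≤tailTerm : ∀ n .{{_ : ℕ.NonZero n}} i → 0ℚ ℚ.≤ tailTerm n i
  0≤tailTerm n i = 0≤frac 1 (J (n ℕ.+ i) ℕ.^ 2)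
    {{ℕ.m^n≢0 (J (n ℕ.+ i)) 2 {{J-nonZero (n ℕ.+ i) {{+-nonZero n i}}}}}}

  p≤p+q : ∀ p {q} → 0ℚ ℚ.≤ q → p ℚ.≤ p ℚ.+ q
  p≤p+q p {q} 0≤q = subst (ℚ._≤ p ℚ.+ q) (ℚ.+-identityʳ p) (ℚ.+-monoʳ-≤ p 0≤q)

  descend : ∀ (f : ℕ → ℚ) → (∀ n → f (suc n) ℚ.≤ f n) → ∀ {m n} → m ℕ.≤′ n → f n ℚ.≤ f m
  descend f step ℕ.≤′-refl       = ℚ.≤-refl
  descend f step (ℕ.≤′-step m≤n) = ℚ.≤-trans (step _) (descend f step m≤n)

  ascend : ∀ (f : ℕ → ℚ) → (∀ n → f n ℚ.≤ f (suc n)) → ∀ {m n} → m ℕ.≤′ n → f m ℚ.≤ f n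
  ascend f step ℕ.≤′-refl       = ℚ.≤-refl
  ascend f step (ℕ.≤′-step m≤n) = ℚ.≤-trans (ascend f step m≤n) (step _)

  partialSum-mono : ∀ a → (∀ i → 0ℚ ℚ.≤ a i) → ∀ {m n} → m ℕ.≤ n → partialSum a m ℚ.≤ partialSum a n
  partialSum-mono a 0≤a m≤n = ascend (partialSum a) (λ n → p≤p+q _ (0≤a n)) (ℕ.≤⇒≤′ m≤n)

  majorant-small : ∀ ε → 0ℚ ℚ.< ε → ∃[ N ] majorant N ℚ.< ε
  majorant-small ε@(mkℚ (+ zero) d _) 0<ε =
    contradiction (ℚ.toℚᵘ-mono-< 0<ε) λ { (ℚᵘ.*<* (ℤ.+<+ ())) }
  majorant-small (mkℚ (-[1+ n ]) d _) (*<* ())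
  majorant-small ε@(mkℚ (+ suc n) d _) _ = N , ℚ.toℚᵘ-cancel-< (begin-strict
    toℚᵘ (majorant N)     ≃⟨ ℚ.toℚᵘ-fromℚᵘ (mkℚᵘ (+ 8) N) ⟩
    mkℚᵘ (+ 8) N          <⟨ ℚᵘ.*<* (subst₂ ℤ._<_ (ℤ.pos-* 8 (suc d)) (ℤ.pos-* (suc n) (suc N))
                              (ℤ.+<+ (ℕ.m≤m+n (suc N) (n ℕ.* suc N)))) ⟩
    toℚᵘ ε                ∎)
    where
    open ℚᵘ.≤-Reasoning
    N = 8 ℕ.* suc d

  ∣∣< : ∀ {p ε} → p ℚ.< ε → ℚ.- p ℚ.< ε → ∣ p ∣ ℚ.< ε
  ∣∣< {p} p<ε -p<ε with ℚ.∣p∣≡p∨∣p∣≡-p p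
  ... | inj₁ eq = subst (ℚ._< _) (sym eq) p<ε
  ... | inj₂ eq = subst (ℚ._< _) (sym eq) -p<ε

  neg-sub : ∀ p q → ℚ.- (p ℚ.- q) ≡ q ℚ.- p
  neg-sub = solve 2 (λ p q → :- (p :- q) := q :- p) refl
    where open ℚSolver.+-*-Solver

tail-summable : ∀ n .{{_ : ℕ.NonZero n}} → Summable (tailTerm n)
tail-summable n ε 0<ε with majorant-small ε 0<ε
... | N , small = N , λ i j N≤i N≤j →
    ∣∣< (close N≤i N≤j) (subst (ℚ._< ε) (sym (neg-sub (P i) (P j))) (close N≤j N≤i))
  where
  open ℚ.≤-Reasoning
  P = partialSum (tailTerm n)
  step : ∀ i → P (suc i) ℚ.+ majorant (suc i) ℚ.≤ P i ℚ.+ majorant i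
  step i = subst (ℚ._≤ P i ℚ.+ majorant i) (sym (ℚ.+-assoc (P i) _ _))
    (ℚ.+-monoʳ-≤ (P i) (tailTerm-bound n i))
  cancel : ∀ p q → (p ℚ.+ q) ℚ.- p ≡ q
  cancel = solve 2 (λ p q → (p :+ q) :- p := q) refl
    where open ℚSolver.+-*-Solver
  close : ∀ {i j} → N ℕ.≤ i → N ℕ.≤ j → P i ℚ.- P j ℚ.< ε
  close {i} {j} N≤i N≤j = begin-strict
    P i ℚ.- P j                     ≤⟨ ℚ.+-monoˡ-≤ (ℚ.- P j) (p≤p+q (P i) (0≤frac 8 (suc i))) ⟩
    (P i ℚ.+ majorant i) ℚ.- P j    ≤⟨ ℚ.+-mono-≤
                                         (descend (λ i → P i ℚ.+ majorant i) step (ℕ.≤⇒≤′ N≤i))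
                                         (ℚ.neg-antimono-≤ (partialSum-mono (tailTerm n) (0≤tailTerm n) N≤j)) ⟩
    (P N ℚ.+ majorant N) ℚ.- P N    ≡⟨ cancel (P N) (majorant N) ⟩
    majorant N                      <⟨ small ⟩
    ε                               ∎

∑1/J²-from : (n : ℕ) .{{_ : ℕ.NonZero n}} → ℝ
∑1/J²-from n = ∑∞ (tailTerm n) (tail-summable n)

∑1/J²-positive : ∀ n .{{_ : ℕ.NonZero n}} → 0ʳ <ʳ ∑1/J²-from n
∑1/J²-positive n = tailTerm n 0 , 0<t , 1 , λ m 1≤m →
  partialSum-mono (tailTerm n) (0≤tailTerm n) 1≤m
  where
  j² = J (n ℕ.+ 0) ℕ.^ 2
  instance
    j²-nonZero : ℕ.NonZero j²
    j²-nonZero = ℕ.m^n≢0 (J (n ℕ.+ 0)) 2 {{J-nonZero (n ℕ.+ 0) {{+-nonZero n 0}}}}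
  0<t : 0ℚ ℚ.< tailTerm n 0
  0<t = ℚ.positive⁻¹ _ {{ℚ.normalize-pos 1 j²}}

{-# OPTIONS --safe #-}
-- With a, b, c = J (k ∸ 1), J k, J (k + 1), the inequality
-- 1 / b² + 1 / (b c) ≤ 1 / (a b) is equivalent to 2 a² ≤ b², which holds for
-- k ≥ 3.  Telescoping, every partial sum of the tail from n ≥ 3 is at most
-- 1 / (J (n ∸ 1) J n).  For n = 1 the claimed bound is 0.
module Submission where

open import Data.Integer using (ℤ; +_; _≥_)
import Data.Integer.Base as ℤ
open import Data.Nat using (ℕ; zero; suc; NonZero; _+_; _∸_; _*_; _^_; _%_; _≤_)
import Data.Nat.Properties as ℕ
open import Data.Nat.Tactic.RingSolver using (solve-∀)
open import Data.Product.Base using (_×_; _,_; proj₁; proj₂)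
open import Data.Rational.Base as ℚ using (ℚ; 0ℚ; 1ℚ; _/_; toℚᵘ)
import Data.Rational.Properties as ℚ
open import Data.Rational.Unnormalised.Base as ℚᵘ using (mkℚᵘ; *≤*)
import Data.Rational.Unnormalised.Properties as ℚᵘ
open import Relation.Binary.PropositionalEquality using (_≡_; sym; cong; subst; subst₂)
open import Relation.Nullary using (yes; no; contradiction)
open import Defs

toℚᵘ-/ : ∀ p q .{{_ : NonZero q}} → toℚᵘ (p / q) ℚᵘ.≃ p ℚᵘ./ q
toℚᵘ-/ p (suc q) = ℚ.toℚᵘ-fromℚᵘ (mkℚᵘ p q)

1/x+1/y≤1/z : ∀ x y z .{{_ : NonZero x}} .{{_ : NonZero y}} .{{_ : NonZero z}} →
  (y + x) * z ≤ x * y → (+ 1 / x) ℚ.+ (+ 1 / y) ℚ.≤ (+ 1 / z)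
1/x+1/y≤1/z x@(suc _) y@(suc _) z@(suc _) le = ℚ.toℚᵘ-cancel-≤ (begin
  toℚᵘ ((+ 1 / x) ℚ.+ (+ 1 / y))         ≃⟨ ℚ.toℚᵘ-homo-+ (+ 1 / x) (+ 1 / y) ⟩
  toℚᵘ (+ 1 / x) ℚᵘ.+ toℚᵘ (+ 1 / y)     ≃⟨ ℚᵘ.+-cong (toℚᵘ-/ (+ 1) x) (toℚᵘ-/ (+ 1) y) ⟩
  (+ 1 ℚᵘ./ x) ℚᵘ.+ (+ 1 ℚᵘ./ y)         ≤⟨ *≤* (ℤ.+≤+ (subst₂ _≤_
                                              (cong (_* z) (units y x)) (sym (ℕ.*-identityˡ (x * y))) le)) ⟩
  + 1 ℚᵘ./ z                             ≃⟨ ℚᵘ.≃-sym (toℚᵘ-/ (+ 1) z) ⟩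
  toℚᵘ (+ 1 / z)                         ∎)
  where
  open ℚᵘ.≤-Reasoning
  units : ∀ y x → y + x ≡ 1 * y + 1 * x
  units = solve-∀

-- The ratio r of consecutive terms is followed by 1 + 2 / r, which decreases in r. So 4 above gives
-- 3/2 below at the next index and conversely; hence the joint induction. It starts at `J 2`, since
-- `J 1` and `J 2` are equal.
J-ratio : ∀ m → 3 * J (2 + m) ≤ 2 * J (3 + m) × J (3 + m) ≤ 4 * J (2 + m)
J-ratio zero = ℕ.m≤m+n 3 3 , ℕ.m≤m+n 3 1
J-ratio (suc m) = lower a b (proj₂ (J-ratio m)) , upper a b (proj₁ (J-ratio m))
  where
  open ℕ.≤-Reasoning
  a = J (2 + m)
  b = J (3 + m)
  lower : ∀ a b → b ≤ 4 * a → 3 * b ≤ 2 * (b + 2 * a)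
  lower a b b≤4a = begin
    3 * b              ≡⟨ ℕ.+-comm b (2 * b) ⟩
    2 * b + b          ≤⟨ ℕ.+-monoʳ-≤ (2 * b) b≤4a ⟩
    2 * b + 4 * a      ≡⟨ factor a b ⟩
    2 * (b + 2 * a)    ∎
    where
    factor : ∀ a b → 2 * b + 4 * a ≡ 2 * (b + 2 * a)
    factor = solve-∀
  upper : ∀ a b → 3 * a ≤ 2 * b → b + 2 * a ≤ 4 * b
  upper a b 3a≤2b = begin
    -- Rounding 2 a up to 3 a lets the lower bound apply and still yields 3 b.
    b + 2 * a    ≤⟨ ℕ.+-monoʳ-≤ b (ℕ.*-monoˡ-≤ a (ℕ.n≤1+n 2)) ⟩
    b + 3 * a    ≤⟨ ℕ.+-monoʳ-≤ b 3a≤2b ⟩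
    3 * b        ≤⟨ ℕ.*-monoˡ-≤ b (ℕ.n≤1+n 3) ⟩
    4 * b        ∎

-- The constant 3/2 exceeds the square root of 2: squaring gives 9 a² ≤ 4 b², and 8 ≤ 9.
3a≤2b⇒2a²≤b² : ∀ a b → 3 * a ≤ 2 * b → 2 * (a * a) ≤ b * b
3a≤2b⇒2a²≤b² a b 3a≤2b = ℕ.*-cancelˡ-≤ 4 (begin
  4 * (2 * (a * a))          ≡⟨ ℕ.*-assoc 4 2 (a * a) ⟨
  8 * (a * a)                ≤⟨ ℕ.*-monoˡ-≤ (a * a) (ℕ.n≤1+n 8) ⟩
  9 * (a * a)                ≡⟨ square₃ a ⟩
  (3 * a) * (3 * a)          ≤⟨ ℕ.*-mono-≤ 3a≤2b 3a≤2b ⟩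
  (2 * b) * (2 * b)          ≡⟨ square₂ b ⟩
  4 * (b * b)                ∎)
  where
  open ℕ.≤-Reasoning
  square₃ : ∀ a → 9 * (a * a) ≡ (3 * a) * (3 * a)
  square₃ = solve-∀
  square₂ : ∀ b → (2 * b) * (2 * b) ≡ 4 * (b * b)
  square₂ = solve-∀

JJ-nonZero : ∀ m → NonZero (J (2 + m) * J (3 + m))
JJ-nonZero m = ℕ.m*n≢0 (J (2 + m)) (J (3 + m)) {{J-nonZero (2 + m)}} {{J-nonZero (3 + m)}}

-- The telescoping potential, indexed from where the bounds of `J-ratio` start.
1/JJ : ℕ → ℚ
1/JJ m = (+ 1 / (J (2 + m) * J (3 + m))) {{JJ-nonZero m}}

0≤1/JJ : ∀ m → 0ℚ ℚ.≤ 1/JJ m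
0≤1/JJ m = ℚ.nonNegative⁻¹ (1/JJ m)
  {{ℚ.normalize-nonNeg 1 (J (2 + m) * J (3 + m)) {{JJ-nonZero m}}}}

-- The recurrence unfolds `J (4 + m)` to b + 2 a. After cross-multiplication both sides contain 2 a
-- b³, and b² times 2 a² ≤ b² remains.
1/J²+1/JJ≤1/JJ : ∀ m → 1/J² (3 + m) ℚ.+ 1/JJ (suc m) ℚ.≤ 1/JJ m
1/J²+1/JJ≤1/JJ m = 1/x+1/y≤1/z (b ^ 2) (b * J (4 + m)) (a * b)
  {{ℕ.m^n≢0 b 2 {{J-nonZero (3 + m)}}}} {{JJ-nonZero (suc m)}} {{JJ-nonZero m}}
  (begin
    (b * (b + 2 * a) + b ^ 2) * (a * b)                   ≡⟨ expandˡ a b ⟩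
    (b * b) * (2 * (a * a)) + (b * b) * (2 * (a * b))     ≤⟨ ℕ.+-monoˡ-≤ _ (ℕ.*-monoʳ-≤ (b * b)
                                                              (3a≤2b⇒2a²≤b² a b (proj₁ (J-ratio m)))) ⟩
    (b * b) * (b * b) + (b * b) * (2 * (a * b))           ≡⟨ expandʳ a b ⟩
    b ^ 2 * (b * (b + 2 * a))                             ∎)
  where
  open ℕ.≤-Reasoning
  a = J (2 + m)
  b = J (3 + m)
  -- `b * (b * 1)` is what `b ^ 2` computes to.
  expandˡ : ∀ a b → (b * (b + 2 * a) + b * (b * 1)) * (a * b)
          ≡ (b * b) * (2 * (a * a)) + (b * b) * (2 * (a * b))
  expandˡ = solve-∀
  expandʳ : ∀ a b → (b * b) * (b * b) + (b * b) * (2 * (a * b)) ≡ b * (b * 1) * (b * (b + 2 * a))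
  expandʳ = solve-∀

-- By `step`, the quantity `partialSum a N ℚ.+ t N` never increases with N, and at N = 0 it equals
-- `t 0`.
partialSum-telescope : ∀ (a t : ℕ → ℚ) → (∀ i → a i ℚ.+ t (suc i) ℚ.≤ t i) →
  ∀ N → partialSum a N ℚ.+ t N ℚ.≤ t 0
partialSum-telescope a t step zero    = ℚ.≤-reflexive (ℚ.+-identityˡ (t 0))
partialSum-telescope a t step (suc N) = begin
  (partialSum a N ℚ.+ a N) ℚ.+ t (suc N)    ≡⟨ ℚ.+-assoc (partialSum a N) (a N) (t (suc N)) ⟩
  partialSum a N ℚ.+ (a N ℚ.+ t (suc N))    ≤⟨ ℚ.+-monoʳ-≤ (partialSum a N) (step N) ⟩
  partialSum a N ℚ.+ t N                    ≤⟨ partialSum-telescope a t step N ⟩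
  t 0                                       ∎
  where open ℚ.≤-Reasoning

tailSum≤1/JJ : ∀ m N → partialSum (tailTerm (3 + m)) N ℚ.≤ 1/JJ m
tailSum≤1/JJ m N = begin
  P                        ≡⟨ ℚ.+-identityʳ P ⟨
  -- The leftover potential is nonnegative, so adding it only enlarges the sum.
  P ℚ.+ 0ℚ                 ≤⟨ ℚ.+-monoʳ-≤ P (0≤1/JJ (m + N)) ⟩
  P ℚ.+ 1/JJ (m + N)       ≤⟨ partialSum-telescope (tailTerm (3 + m)) (λ i → 1/JJ (m + i)) step N ⟩
  1/JJ (m + 0)             ≡⟨ cong 1/JJ (ℕ.+-identityʳ m) ⟩
  1/JJ m                   ∎
  where
  open ℚ.≤-Reasoning
  P = partialSum (tailTerm (3 + m)) N
  step : ∀ i → tailTerm (3 + m) i ℚ.+ 1/JJ (m + suc i) ℚ.≤ 1/JJ (m + i)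
  step i = subst (λ j → tailTerm (3 + m) i ℚ.+ 1/JJ j ℚ.≤ 1/JJ (m + i))
    (sym (ℕ.+-suc m i)) (1/J²+1/JJ≤1/JJ (m + i))

d/1*1/d≡1 : ∀ d .{{_ : NonZero d}} → (+ d / 1) ℚ.* (+ 1 / d) ≡ 1ℚ
d/1*1/d≡1 d@(suc _) = ℚ.toℚᵘ-injective (begin
  toℚᵘ ((+ d / 1) ℚ.* (+ 1 / d))        ≈⟨ ℚ.toℚᵘ-homo-* (+ d / 1) (+ 1 / d) ⟩
  toℚᵘ (+ d / 1) ℚᵘ.* toℚᵘ (+ 1 / d)    ≈⟨ ℚᵘ.*-cong (toℚᵘ-/ (+ d) 1) (toℚᵘ-/ (+ 1) d) ⟩
  (+ d ℚᵘ./ 1) ℚᵘ.* (+ 1 ℚᵘ./ d)        ≈⟨ ℚᵘ.*≡* (cong +_ (swap d)) ⟩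
  toℚᵘ 1ℚ                               ∎)
  where
  open ℚᵘ.≃-Reasoning
  swap : ∀ d → d * 1 * 1 ≡ 1 * (1 * d)
  swap = solve-∀

-- The product form d p ≤ 1 also makes sense for d = 0, so n = 1 can share it.
p≤1/d⇒d*p≤1 : ∀ d .{{_ : NonZero d}} {p} → p ℚ.≤ (+ 1 / d) → (+ d / 1) ℚ.* p ℚ.≤ 1ℚ
p≤1/d⇒d*p≤1 d {p} p≤1/d = subst ((+ d / 1) ℚ.* p ℚ.≤_) (d/1*1/d≡1 d)
  (ℚ.*-monoˡ-≤-nonNeg (+ d / 1) {{ℚ.normalize-nonNeg d 1}} p≤1/d)

q*p≤1⇒q≤recip : ∀ q p → 0ℚ ℚ.< p → q ℚ.* p ℚ.≤ 1ℚ → q ℚ.≤ recip p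
q*p≤1⇒q≤recip q p 0<p qp≤1 with p ℚ.≟ 0ℚ
-- Positivity excludes the default value of `recip` at 0.
... | yes p≡0 = contradiction (sym p≡0) (ℚ.<⇒≢ 0<p)
... | no  p≢0 = ℚ.*-cancelʳ-≤-pos p {{ℚ.positive 0<p}}
  (subst (q ℚ.* p ℚ.≤_) (sym (ℚ.*-inverseˡ p {{ℚ.≢-nonZero p≢0}})) qp≤1)

≤ʳ-inverse : ∀ d x (0<x : 0ʳ <ʳ x) → (∀ N → (d / 1) ℚ.* seq x N ℚ.≤ 1ℚ) →
  fromℤ d ≤ʳ inverse x 0<x
-- From the N of the positivity witness on, `seq x n` is at least δ, so `recip` is a true reciprocal
-- there.
≤ʳ-inverse d x (δ , 0<δ , N , δ≤x) dx≤1 ε 0<ε = N , λ n N≤n → begin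
  d / 1                     ≤⟨ q*p≤1⇒q≤recip (d / 1) (seq x n)
                                 (ℚ.<-≤-trans 0<δ (subst (ℚ._≤ seq x n) (ℚ.+-identityˡ δ) (δ≤x n N≤n)))
                                 (dx≤1 n) ⟩
  recip (seq x n)           ≡⟨ ℚ.+-identityʳ _ ⟨
  recip (seq x n) ℚ.+ 0ℚ    ≤⟨ ℚ.+-monoʳ-≤ (recip (seq x n)) (ℚ.<⇒≤ 0<ε) ⟩
  recip (seq x n) ℚ.+ ε     ∎
  where open ℚ.≤-Reasoning

JJ*tailSum≤1 : ∀ n .{{_ : NonZero n}} → n % 2 ≡ 1 →
  ∀ N → (+ (J (n ∸ 1) * J n) / 1) ℚ.* partialSum (tailTerm n) N ℚ.≤ 1ℚ
-- An odd n is 1 or of the form 3 + m; n = 2 is absurd because `2 % 2` computes to 0. Here `J 0`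
-- makes the product vanish.
JJ*tailSum≤1 1 _ N = ℚ.≤-trans (ℚ.≤-reflexive (ℚ.*-zeroˡ (partialSum (tailTerm 1) N)))
  (ℚ.nonNegative⁻¹ 1ℚ)
JJ*tailSum≤1 (suc (suc (suc m))) _ N = p≤1/d⇒d*p≤1 (J (2 + m) * J (3 + m)) {{JJ-nonZero m}} (tailSum≤1/JJ m N)

theorem2p2 : ∀ (n : ℕ) .{{_ : NonZero n}} → n % 2 ≡ 1 →
    ∀ (m : ℤ) → ⌊ inverse (∑1/J²-from n) (∑1/J²-positive n) ⌋≡ m →
    m ≥ + (J (n ∸ 1) * J n)
-- Maximality of the floor reduces the claim to an inequality between an integer and the real
-- inverse.
theorem2p2 n odd m (_ , m-max) = m-max (+ (J (n ∸ 1) * J n))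
  (≤ʳ-inverse (+ (J (n ∸ 1) * J n)) (∑1/J²-from n) (∑1/J²-positive n) (JJ*tailSum≤1 n odd))
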